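{- Let $\Delta$ be a $d$-dimensional lattice simplex, $N=N_\Delta$, and let $g_\Delta$ be an $m\times(d+1)$ matrix over $\mathbb{Z}_N$ whose rows generate the code $C_\Delta$; denote its columns by $g_0,\dots,g_d$ and put $H_i=\{x\in\mathbb{Z}_N^m: g_i\cdot x=0 \bmod N\}$. Then $\Delta$ is thin if and only if the complement of the hyperplane arrangement $\mathcal{H}_\Delta=\{H_0,\dots,H_d\}$ is empty, i.e. $\mathbb{Z}_N^m=H_0\cup H_1\cup\dots\cup H_d$.
   Context: Let $M\cong\mathbb{Z}^d$ be a lattice and $\Delta$ a $d$-dimensional lattice simplex in $M\otimes\mathbb{R}$ with vertices $v_0,\dots,v_d\in M$. The local $h^*$-polynomial is $l^*(\Delta,t)=\sum_{\lambda}t^{\lambda_{d+1}}$, the sum being over the points $\lambda\in M\oplus\mathbb{Z}$ in the open parallelepiped $\Pi_\Delta^\circ=\{\sum_{i=0}^d a_i(v_i,1):0<a_i<1\}$, where $\lambda_{d+1}$ is the last coordinate. $\Delta$ is called thin if $l^*(\Delta,t)=0$. Code of a simplex: $\mathbb{Z}_N=\mathbb{Z}/N\mathbb{Z}$. Let $\Lambda_\Delta=\{x\in(\mathbb{R}/\mathbb{Z})^{d+1}:\sum_i\{x_i\}(v_i,1)\in M\oplus\mathbb{Z}\}$, where $\{\cdot\}$ is the fractional part. $N_\Delta$ is the least common multiple of the denominators of all coordinates of elements of $\Lambda_\Delta$, and $C_\Delta=\{(N_\Delta\{x_0\},\dots,N_\Delta\{x_d\}):x\in\Lambda_\Delta\}\subseteq\mathbb{Z}_{N_\Delta}^{d+1}$,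 a $\mathbb{Z}_{N_\Delta}$-submodule. -}

module Defs where

open import Algebra.Bundles using (CommutativeRing)
import Algebra.Properties.Semiring.Sum as SemiringSum
open import Data.Bool.Base using (if_then_else_)
open import Data.Fin.Base using (Fin; zero; suc; toℕ; fromℕ; inject₁; punchIn)
open import Data.Fin.Properties using (all?; any?)
open import Data.Integer.Base as ℤ using (ℤ; +_; -[1+_]; 1ℤ)
import Data.Integer.Properties as ℤ
open import Data.List.Base as List using (List; []; _∷_; _++_)
open import Data.List.Membership.Propositional using (_∈_)
open import Data.List.Membership.Propositional.Properties
  using (∈-map⁺; ∈-map⁻; ∈-++⁺ˡ; ∈-++⁺ʳ; ∈-upTo⁺; ∈-filter⁺; ∈-filter⁻;
         ∈-cartesianProductWith⁺; ∈-deduplicate⁺; ∈-deduplicate⁻)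
open import Data.List.Relation.Unary.All as All using (All; []; _∷_)
import Data.List.Relation.Unary.All.Properties as All
open import Data.List.Relation.Unary.Any using (here)
open import Data.List.Relation.Unary.Unique.Propositional using (Unique)
open import Data.List.Relation.Unary.Unique.DecPropositional.Properties
  using (deduplicate-!)
open import Data.Nat.Base as ℕ using (ℕ; zero; suc; s≤s)
import Data.Nat.Divisibility as ℕ
open import Data.Nat.DivMod using (_mod_)
open import Data.Nat.LCM using (lcm; lcm-least)
import Data.Nat.Properties as ℕ
open import Data.Product.Base using (∃; _×_; _,_; proj₁; proj₂)
open import Data.Rational.Base
  using (ℚ; 0ℚ; 1ℚ; _+_; _*_; -_; _/_; 1/_; _≤_; _<_; ∣_∣; ↧ₙ_; toℚᵘ; ≢-nonZero)
import Data.Rational.Properties as ℚ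
open import Data.Rational.Solver using (module +-*-Solver)
open import Data.Rational.Unnormalised.Base as ℚᵘ using (mkℚᵘ)
import Data.Rational.Unnormalised.Properties as ℚᵘ
open import Data.Vec.Base as Vec using (Vec; []; _∷_; _∷ʳ_; lookup)
import Data.Vec.Properties as Vec
open import Data.Vec.Functional using (Vector; insertAt)
open import Data.Vec.Functional.Properties using (insertAt-lookup; insertAt-punchIn)
open import Function.Base using (_∘_)
open import Function.Bundles using (_⇔_; mk⇔)
open import Level using (0ℓ)
open import Relation.Binary.Definitions using (DecidableEquality)
open import Relation.Binary.PropositionalEquality
open import Relation.Nullary using (yes; no; does)
open import Relation.Nullary.Decidable using (¬?; _×-dec_)
import Relation.Nullary.Decidable as Dec
open import Relation.Unary using (Pred; Decidable)

module ∑ℚ = SemiringSum (CommutativeRing.semiring ℚ.+-*-commutativeRing)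
module ∑ℕ = SemiringSum ℕ.+-*-semiring

open ∑ℚ using (sum-syntax)

------------------------------------------------------------------------
-- Lattice simplices

ι : ℤ → ℚ
ι z = z / 1

-- Rational coefficients suffice: (v₀,1), …, (v_d,1) are integral and
-- linearly independent, so the real coefficients expressing a lattice
-- point in terms of them are rational, and affine independence of lattice
-- points over ℚ and over ℝ are the same condition.

record LatticeSimplex (d : ℕ) : Set where
  field
    vertex : Fin (suc d) → Vec ℤ d
    affinelyIndependent :
      (c : Fin (suc d) → ℚ) →
      ∑[ i < suc d ] c i ≡ 0ℚ →
      (∀ j → ∑[ i < suc d ] (c i * ι (lookup (vertex i) j)) ≡ 0ℚ) →
      ∀ i → c i ≡ 0ℚ

  -- (vᵢ , 1) ∈ M ⊕ ℤ ≅ ℤᵈ⁺¹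
  cone : Fin (suc d) → Vec ℤ (suc d)
  cone i = vertex i ∷ʳ 1ℤ

open LatticeSimplex public

-- p ≐∑ a ∙ w  means  p = ∑ᵢ aᵢ wᵢ.
infix 4 _≐∑_∙_
_≐∑_∙_ : ∀ {n k} → Vec ℤ k → Vec ℚ n → (Fin n → Vec ℤ k) → Set
_≐∑_∙_ {n} p a w = ∀ j → ι (lookup p j) ≡ ∑[ i < n ] (lookup a i * ι (lookup (w i) j))

-- The lattice points of the open parallelepiped Π°_Δ.
Π° : ∀ {d} → LatticeSimplex d → Pred (Vec ℤ (suc d)) 0ℓ
Π° Δ p = ∃ λ a → (∀ i → 0ℚ < lookup a i × lookup a i < 1ℚ) × p ≐∑ a ∙ cone Δ

-- Λ_Δ, with each class in ℝ/ℤ represented by its fractional part, i.e. by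
-- its unique representative in [0,1).
Λ : ∀ {d} → LatticeSimplex d → Pred (Vec ℚ (suc d)) 0ℓ
Λ Δ x = (∀ i → 0ℚ ≤ lookup x i × lookup x i < 1ℚ) × ∃ λ p → p ≐∑ x ∙ cone Δ

------------------------------------------------------------------------
-- Finiteness of Π°_Δ and Λ_Δ

record Enumeration {A : Set} (P : Pred A 0ℓ) : Set where
  field
    elements : List A
    unique   : Unique elements
    complete : ∀ {x} → x ∈ elements ⇔ P x

open Enumeration public

private
  enumerate : ∀ {A : Set} {P : Pred A 0ℓ} → DecidableEquality A →
              (xs : List A) → (∀ {x} → x ∈ xs → P x) → (∀ {x} → P x → x ∈ xs) →
              Enumeration P
  enumerate _≟_ xs to from = record
    { elements = List.deduplicate _≟_ xs
    ; unique   = deduplicate-! _≟_ xs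
    ; complete = mk⇔ (to ∘ ∈-deduplicate⁻ _≟_ xs) (∈-deduplicate⁺ _≟_ ∘ from)
    }

  lookup-ext : ∀ {A : Set} {n} {xs ys : Vec A n} → (∀ i → lookup xs i ≡ lookup ys i) → xs ≡ ys
  lookup-ext {xs = []}    {[]}    h = refl
  lookup-ext {xs = _ ∷ _} {_ ∷ _} h = cong₂ _∷_ (h zero) (lookup-ext (h ∘ suc))

  ι≃ : ∀ z → toℚᵘ (ι z) ℚᵘ.≃ mkℚᵘ z 0
  ι≃ z = ℚ.toℚᵘ-fromℚᵘ (mkℚᵘ z 0)

  ι-cancel-≤ : ∀ {x y} → ι x ≤ ι y → x ℤ.≤ y
  ι-cancel-≤ {x} {y} le
    with ℚᵘ.≤-respˡ-≃ (ι≃ x) (ℚᵘ.≤-respʳ-≃ (ι≃ y) (ℚ.toℚᵘ-mono-≤ le))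
  ... | ℚᵘ.*≤* h = subst₂ ℤ._≤_ (ℤ.*-identityʳ x) (ℤ.*-identityʳ y) h

  ι-+ : ∀ x y → ι x + ι y ≡ ι (x ℤ.+ y)
  ι-+ x y = ℚ.toℚᵘ-injective (ℚᵘ.≃-trans (ℚ.toℚᵘ-homo-+ (ι x) (ι y))
    (ℚᵘ.≃-trans (ℚᵘ.+-cong (ι≃ x) (ι≃ y)) (ℚᵘ.≃-trans
      (ℚᵘ.*≡* (cong (ℤ._* 1ℤ) (cong₂ ℤ._+_ (ℤ.*-identityʳ x) (ℤ.*-identityʳ y))))
      (ℚᵘ.≃-sym (ι≃ (x ℤ.+ y))))))

  ι-∣∣ : ∀ z → ∣ ι z ∣ ≡ ι (+ ℤ.∣ z ∣)
  ι-∣∣ z = ℚ.toℚᵘ-injective (ℚᵘ.≃-trans (ℚ.toℚᵘ-homo-∣-∣ (ι z))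
    (ℚᵘ.≃-trans (ℚᵘ.∣-∣-cong (ι≃ z)) (ℚᵘ.≃-sym (ι≃ (+ ℤ.∣ z ∣)))))

  -- More vectors than coordinates are linearly dependent.
  dependent : ∀ n (w : Fin (suc n) → Fin n → ℚ) →
              ∃ λ (c : Fin (suc n) → ℚ) → (∃ λ i → c i ≢ 0ℚ) ×
                (∀ j → ∑[ i < suc n ] (c i * w i j) ≡ 0ℚ)
  dependent zero    w = (λ _ → 1ℚ) , (zero , λ ()) , λ ()
  dependent (suc n) w with any? (λ i → ¬? (w i zero ℚ.≟ 0ℚ))
  ... | no ¬pivot = c , (suc k , ck≢0) , eqs
    where
    w₀≡0 : ∀ i → w i zero ≡ 0ℚ
    w₀≡0 i = Dec.decidable-stable (w i zero ℚ.≟ 0ℚ) (λ ne → ¬pivot (i , ne))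

    IH = dependent n (λ i j → w (suc i) (suc j))
    k = proj₁ (proj₁ (proj₂ IH))
    ck≢0 = proj₂ (proj₁ (proj₂ IH))

    c : Fin (suc (suc n)) → ℚ
    c zero    = 0ℚ
    c (suc i) = proj₁ IH i

    eqs : ∀ j → ∑[ i < suc (suc n) ] (c i * w i j) ≡ 0ℚ
    eqs zero    = trans
      (∑ℚ.sum-cong-≗ (λ i → trans (cong (c i *_) (w₀≡0 i)) (ℚ.*-zeroʳ (c i))))
      (∑ℚ.sum-replicate-zero (suc (suc n)))
    eqs (suc j) = trans
      (cong (λ q → q + S) (ℚ.*-zeroˡ (w zero (suc j))))
      (trans (ℚ.+-identityˡ S) (proj₂ (proj₂ IH) j))
      where S = ∑[ i < suc n ] (proj₁ IH i * w (suc i) (suc j))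
  ... | yes (p , r≢0) = c , (punchIn p k , ck≢0) , eqs
    where
    r = w p zero
    w′ : Fin (suc n) → Fin (suc n) → ℚ
    w′ i = w (punchIn p i)

    u : Fin (suc n) → Fin (suc n) → ℚ
    u i j = r * w′ i j + - (w′ i zero * w p j)

    IH = dependent n (λ i j → u i (suc j))
    c′ = proj₁ IH
    k  = proj₁ (proj₁ (proj₂ IH))

    f : Fin (suc n) → ℚ
    f i = c′ i * w′ i zero

    c″ : Fin (suc n) → ℚ
    c″ i = c′ i * r

    c : Fin (suc (suc n)) → ℚ
    c = insertAt c″ p (- ∑ℚ.sum f)

    ck≢0 : c (punchIn p k) ≢ 0ℚ
    ck≢0 eq = proj₂ (proj₁ (proj₂ IH)) (begin
      c′ k                ≡⟨ ℚ.*-identityʳ (c′ k) ⟨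
      c′ k * 1ℚ           ≡⟨ cong (c′ k *_) (ℚ.*-inverseʳ r) ⟨
      c′ k * (r * 1/ r)   ≡⟨ ℚ.*-assoc (c′ k) r (1/ r) ⟨
      c′ k * r * 1/ r     ≡⟨ cong (_* 1/ r) (trans (sym (insertAt-punchIn c″ p _ k)) eq) ⟩
      0ℚ * 1/ r           ≡⟨ ℚ.*-zeroˡ (1/ r) ⟩
      0ℚ                  ∎)
      where
      open ≡-Reasoning
      instance _ = ≢-nonZero r≢0

    reduce : ∀ j → ∑[ i < suc (suc n) ] (c i * w i j) ≡ ∑[ i < suc n ] (c′ i * u i j)
    reduce j = begin
      ∑[ i < suc (suc n) ] (c i * w i j)
        ≡⟨ ∑ℚ.sum-remove {i = p} (λ i → c i * w i j) ⟩
      c p * w p j + ∑[ i < suc n ] (c (punchIn p i) * w′ i j)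
        ≡⟨ cong₂ _+_ (cong (_* w p j) (insertAt-lookup c″ p _))
             (∑ℚ.sum-cong-≗ (λ i → cong (_* w′ i j) (insertAt-punchIn c″ p (- ∑ℚ.sum f) i))) ⟩
      - ∑ℚ.sum f * w p j + ∑[ i < suc n ] (c″ i * w′ i j)
        ≡⟨ cong (λ q → q + S) (trans (sym (ℚ.neg-distribˡ-* (∑ℚ.sum f) (w p j)))
             (trans (ℚ.neg-distribʳ-* (∑ℚ.sum f) (w p j))
               (∑ℚ.*-distribʳ-sum (- w p j) f))) ⟩
      ∑[ i < suc n ] (f i * - w p j) + ∑[ i < suc n ] (c″ i * w′ i j)
        ≡⟨ ∑ℚ.∑-distrib-+ (λ i → f i * - w p j) (λ i → c″ i * w′ i j) ⟨
      ∑[ i < suc n ] (f i * - w p j + c″ i * w′ i j)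
        ≡⟨ ∑ℚ.sum-cong-≗ (λ i → solve 5
             (λ x y z t s → x :* y :* :- z :+ x :* t :* s := x :* (t :* s :+ :- (y :* z)))
             refl (c′ i) (w′ i zero) (w p j) r (w′ i j)) ⟩
      ∑[ i < suc n ] (c′ i * u i j) ∎
      where
      open ≡-Reasoning
      open +-*-Solver
      S = ∑[ i < suc n ] (c″ i * w′ i j)

    eqs : ∀ j → ∑[ i < suc (suc n) ] (c i * w i j) ≡ 0ℚ
    eqs (suc j) = trans (reduce (suc j)) (proj₂ (proj₂ IH) j)
    eqs zero    = trans (reduce zero) (trans
      (∑ℚ.sum-cong-≗ (λ i → solve 3
         (λ x y t → x :* (t :* y :+ :- (y :* t)) := con 0ℚ) refl (c′ i) (w′ i zero) r))
      (∑ℚ.sum-replicate-zero (suc n)))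
      where open +-*-Solver

  module Basis {n} (w : Fin n → Vec ℤ n)
    (independent : (c : Fin n → ℚ) →
      (∀ j → ∑[ i < n ] (c i * ι (lookup (w i) j)) ≡ 0ℚ) → ∀ i → c i ≡ 0ℚ) where

    solution : ∀ p → ∃ λ a → p ≐∑ a ∙ w
    solution p = a , eqs
      where
      v : Fin (suc n) → Fin n → ℚ
      v zero    j = ι (lookup p j)
      v (suc i) j = ι (lookup (w i) j)

      D  = dependent n v
      c  = proj₁ D
      c₀ = c zero

      relation : ∀ j → c₀ * ι (lookup p j) + ∑[ i < n ] (c (suc i) * v (suc i) j) ≡ 0ℚ
      relation = proj₂ (proj₂ D)

      c₀≢0 : c₀ ≢ 0ℚ
      c₀≢0 c₀≡0 = proj₂ (proj₁ (proj₂ D)) (vanish (proj₁ (proj₁ (proj₂ D))))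
        where
        vanish : ∀ i → c i ≡ 0ℚ
        vanish zero    = c₀≡0
        vanish (suc i) = independent (c ∘ suc) (λ j → begin
          ∑[ i < n ] (c (suc i) * v (suc i) j)        ≡⟨ ℚ.+-identityˡ (S j) ⟨
          0ℚ + ∑[ i < n ] (c (suc i) * v (suc i) j)
            ≡⟨ cong (λ q → q + S j) (trans (cong (_* ι (lookup p j)) c₀≡0) (ℚ.*-zeroˡ (ι (lookup p j)))) ⟨
          c₀ * ι (lookup p j) + ∑[ i < n ] (c (suc i) * v (suc i) j)
            ≡⟨ relation j ⟩
          0ℚ ∎) i
          where
          open ≡-Reasoning
          S : Fin n → ℚ
          S j = ∑[ i < n ] (c (suc i) * v (suc i) j)

      instance _ = ≢-nonZero c₀≢0

      s = - (1/ c₀)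

      a : Vec ℚ n
      a = Vec.tabulate (λ i → s * c (suc i))

      eqs : p ≐∑ a ∙ w
      eqs j = sym (begin
        ∑[ i < n ] (lookup a i * v (suc i) j)
          ≡⟨ ∑ℚ.sum-cong-≗ (λ i → trans
               (cong (_* v (suc i) j) (Vec.lookup∘tabulate (λ i → s * c (suc i)) i))
               (ℚ.*-assoc s (c (suc i)) (v (suc i) j))) ⟩
        ∑[ i < n ] (s * (c (suc i) * v (suc i) j))
          ≡⟨ ∑ℚ.*-distribˡ-sum s (λ i → c (suc i) * v (suc i) j) ⟨
        s * S
          ≡⟨ solve 4 (λ c₀ i x S → :- i :* S := :- i :* (c₀ :* x :+ S) :+ (i :* c₀) :* x)
               refl c₀ (1/ c₀) (ι (lookup p j)) S ⟩
        s * (c₀ * ι (lookup p j) + S) + 1/ c₀ * c₀ * ι (lookup p j)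
          ≡⟨ cong₂ _+_ (trans (cong (s *_) (relation j)) (ℚ.*-zeroʳ s))
               (trans (cong (_* ι (lookup p j)) (ℚ.*-inverseˡ c₀))
                 (ℚ.*-identityˡ (ι (lookup p j)))) ⟩
        0ℚ + ι (lookup p j)
          ≡⟨ ℚ.+-identityˡ (ι (lookup p j)) ⟩
        ι (lookup p j) ∎)
        where
        open ≡-Reasoning
        open +-*-Solver
        S = ∑[ i < n ] (c (suc i) * v (suc i) j)

    coords : Vec ℤ n → Vec ℚ n
    coords p = proj₁ (solution p)

    coords-unique : ∀ p a → p ≐∑ a ∙ w → a ≡ coords p
    coords-unique p a eq = lookup-ext (λ i → begin
        lookup a i                     ≡⟨ ℚ.+-identityʳ (lookup a i) ⟨
        lookup a i + 0ℚ                ≡⟨ cong (λ q → lookup a i + q) (ℚ.+-inverseˡ (lookup b i)) ⟨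
        lookup a i + (- lookup b i + lookup b i)
                                       ≡⟨ ℚ.+-assoc (lookup a i) (- lookup b i) (lookup b i) ⟨
        lookup a i + - lookup b i + lookup b i
                                       ≡⟨ cong (_+ lookup b i) (independent diff diff-eq i) ⟩
        0ℚ + lookup b i                ≡⟨ ℚ.+-identityˡ (lookup b i) ⟩
        lookup b i                     ∎)
      where
      open ≡-Reasoning
      b = coords p
      diff : Fin n → ℚ
      diff i = lookup a i + - lookup b i

      diff-eq : ∀ j → ∑[ i < n ] (diff i * ι (lookup (w i) j)) ≡ 0ℚ
      diff-eq j = begin
        ∑[ i < n ] (diff i * x i)
          ≡⟨ ∑ℚ.sum-cong-≗ (λ i → solve 3
               (λ a b x → (a :+ :- b) :* x := a :* x :+ (b :* x) :* con (- 1ℚ))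
               refl (lookup a i) (lookup b i) (x i)) ⟩
        ∑[ i < n ] (lookup a i * x i + lookup b i * x i * - 1ℚ)
          ≡⟨ ∑ℚ.∑-distrib-+ (λ i → lookup a i * x i) (λ i → lookup b i * x i * - 1ℚ) ⟩
        ∑[ i < n ] (lookup a i * x i) + ∑[ i < n ] (lookup b i * x i * - 1ℚ)
          ≡⟨ cong₂ _+_ (eq j) (∑ℚ.*-distribʳ-sum (- 1ℚ) (λ i → lookup b i * x i)) ⟨
        ι (lookup p j) + (∑[ i < n ] (lookup b i * x i)) * - 1ℚ
          ≡⟨ cong (λ y → ι (lookup p j) + y * - 1ℚ) (proj₂ (solution p) j) ⟨
        ι (lookup p j) + ι (lookup p j) * - 1ℚ
          ≡⟨ solve 1 (λ y → y :+ y :* con (- 1ℚ) := con 0ℚ) refl (ι (lookup p j)) ⟩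
        0ℚ ∎
        where
        open +-*-Solver
        x : Fin n → ℚ
        x i = ι (lookup (w i) j)

    bound : Fin n → ℕ
    bound j = ∑ℕ.sum (λ i → ℤ.∣ lookup (w i) j ∣)

    bounded : ∀ p a → (∀ i → ∣ lookup a i ∣ ≤ 1ℚ) → p ≐∑ a ∙ w →
              ∀ j → ℤ.∣ lookup p j ∣ ℕ.≤ bound j
    bounded p a a≤1 eq j = ℤ.drop‿+≤+ (ι-cancel-≤ (begin
      ι (+ ℤ.∣ lookup p j ∣)    ≡⟨ ι-∣∣ (lookup p j) ⟨
      ∣ ι (lookup p j) ∣        ≡⟨ cong ∣_∣ (eq j) ⟩
      ∣ ∑[ i < n ] (lookup a i * ι (lookup (w i) j)) ∣
                                ≤⟨ go (lookup a) (λ i → lookup (w i) j) a≤1 ⟩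
      ι (+ bound j)             ∎))
      where
      open ℚ.≤-Reasoning
      go : ∀ {m} (a : Fin m → ℚ) (z : Fin m → ℤ) → (∀ i → ∣ a i ∣ ≤ 1ℚ) →
           ∣ ∑[ i < m ] (a i * ι (z i)) ∣ ≤ ι (+ ∑ℕ.sum (λ i → ℤ.∣ z i ∣))
      go {zero}  a z h = ℚ.≤-refl
      go {suc m} a z h = begin
        ∣ a zero * ι (z zero) + S ∣
          ≤⟨ ℚ.∣p+q∣≤∣p∣+∣q∣ (a zero * ι (z zero)) S ⟩
        ∣ a zero * ι (z zero) ∣ + ∣ S ∣
          ≤⟨ ℚ.+-mono-≤ first (go (a ∘ suc) (z ∘ suc) (h ∘ suc)) ⟩
        ι (+ ℤ.∣ z zero ∣) + ι (+ T)
          ≡⟨ ι-+ (+ ℤ.∣ z zero ∣) (+ T) ⟩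
        ι (+ (ℤ.∣ z zero ∣ ℕ.+ T)) ∎
        where
        S = ∑[ i < m ] (a (suc i) * ι (z (suc i)))
        T = ∑ℕ.sum (λ i → ℤ.∣ z (suc i) ∣)
        first : ∣ a zero * ι (z zero) ∣ ≤ ι (+ ℤ.∣ z zero ∣)
        first = begin
          ∣ a zero * ι (z zero) ∣     ≡⟨ ℚ.∣p*q∣≡∣p∣*∣q∣ (a zero) (ι (z zero)) ⟩
          ∣ a zero ∣ * ∣ ι (z zero) ∣
            ≤⟨ ℚ.*-monoʳ-≤-nonNeg ∣ ι (z zero) ∣ {{ℚ.∣-∣-nonNeg (ι (z zero))}} (h zero) ⟩
          1ℚ * ∣ ι (z zero) ∣         ≡⟨ ℚ.*-identityˡ ∣ ι (z zero) ∣ ⟩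
          ∣ ι (z zero) ∣              ≡⟨ ι-∣∣ (z zero) ⟩
          ι (+ ℤ.∣ z zero ∣)          ∎

    range : ℕ → List ℤ
    range b = List.map +_ (List.upTo (suc b)) ++ List.map -[1+_] (List.upTo b)

    ∈-range : ∀ {b} z → ℤ.∣ z ∣ ℕ.≤ b → z ∈ range b
    ∈-range (+ k)    le = ∈-++⁺ˡ (∈-map⁺ +_ (∈-upTo⁺ (s≤s le)))
    ∈-range -[1+ k ] le = ∈-++⁺ʳ (List.map +_ (List.upTo (suc _))) (∈-map⁺ -[1+_] (∈-upTo⁺ le))

    box : ∀ {m} → (Fin m → ℕ) → List (Vec ℤ m)
    box {zero}  b = [] ∷ []
    box {suc m} b = List.cartesianProductWith _∷_ (range (b zero)) (box (b ∘ suc))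

    ∈-box : ∀ {m} {b : Fin m → ℕ} (p : Vec ℤ m) → (∀ j → ℤ.∣ lookup p j ∣ ℕ.≤ b j) → p ∈ box b
    ∈-box []      h = here refl
    ∈-box (x ∷ p) h = ∈-cartesianProductWith⁺ _∷_ (∈-range x (h zero)) (∈-box p (h ∘ suc))

    module _ {P : Pred ℚ 0ℓ} (P? : Decidable P) (P⇒≤1 : ∀ {q} → P q → ∣ q ∣ ≤ 1ℚ) where

      Good : Pred (Vec ℤ n) 0ℓ
      Good p = ∀ i → P (lookup (coords p) i)

      good? : Decidable Good
      good? p = all? (λ i → P? (lookup (coords p) i))

      candidates : List (Vec ℤ n)
      candidates = List.filter good? (box bound)

      ∈-candidates : ∀ p a → (∀ i → P (lookup a i)) → p ≐∑ a ∙ w → p ∈ candidates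
      ∈-candidates p a ok eq = ∈-filter⁺ good? (∈-box p (bounded p a (λ i → P⇒≤1 (ok i)) eq))
        (λ i → subst (λ b → P (lookup b i)) (coords-unique p a eq) (ok i))

      candidates-good : ∀ {p} → p ∈ candidates → Good p
      candidates-good = proj₂ ∘ ∈-filter⁻ good? {xs = box bound}

      pointEnumeration : Enumeration (λ p → ∃ λ a → (∀ i → P (lookup a i)) × p ≐∑ a ∙ w)
      pointEnumeration = enumerate (Vec.≡-dec ℤ._≟_) candidates
        (λ {p} p∈ → coords p , candidates-good p∈ , proj₂ (solution p))
        (λ {p} (a , ok , eq) → ∈-candidates p a ok eq)

      coordEnumeration : Enumeration (λ a → (∀ i → P (lookup a i)) × ∃ λ p → p ≐∑ a ∙ w)
      coordEnumeration = enumerate (Vec.≡-dec ℚ._≟_) (List.map coords candidates)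
        (λ a∈ → let p , p∈ , a≡ = ∈-map⁻ coords a∈ in
          subst (λ a → (∀ i → P (lookup a i)) × ∃ λ p → p ≐∑ a ∙ w) (sym a≡)
            (candidates-good p∈ , p , proj₂ (solution p)))
        (λ {a} (ok , p , eq) → subst (_∈ List.map coords candidates)
          (sym (coords-unique p a eq)) (∈-map⁺ coords (∈-candidates p a ok eq)))

  lookup-∷ʳ-inject₁ : ∀ {A : Set} {n} (xs : Vec A n) x j →
                      lookup (xs ∷ʳ x) (inject₁ j) ≡ lookup xs j
  lookup-∷ʳ-inject₁ (y ∷ xs) x zero    = refl
  lookup-∷ʳ-inject₁ (y ∷ xs) x (suc j) = lookup-∷ʳ-inject₁ xs x j

  lookup-∷ʳ-fromℕ : ∀ {A : Set} {n} (xs : Vec A n) x → lookup (xs ∷ʳ x) (fromℕ n) ≡ x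
  lookup-∷ʳ-fromℕ []       x = refl
  lookup-∷ʳ-fromℕ (y ∷ xs) x = lookup-∷ʳ-fromℕ xs x

  cone-independent : ∀ {d} (Δ : LatticeSimplex d) (c : Fin (suc d) → ℚ) →
    (∀ j → ∑[ i < suc d ] (c i * ι (lookup (cone Δ i) j)) ≡ 0ℚ) → ∀ i → c i ≡ 0ℚ
  cone-independent {d} Δ c eq = affinelyIndependent Δ c
    (trans (∑ℚ.sum-cong-≗ (λ i → sym (trans
        (cong (λ z → c i * ι z) (lookup-∷ʳ-fromℕ (vertex Δ i) 1ℤ)) (ℚ.*-identityʳ (c i)))))
      (eq (fromℕ d)))
    (λ j → trans (∑ℚ.sum-cong-≗ (λ i →
        cong (λ z → c i * ι z) (sym (lookup-∷ʳ-inject₁ (vertex Δ i) 1ℤ j))))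
      (eq (inject₁ j)))

  ∣∣≤1 : ∀ {q} → 0ℚ ≤ q → q < 1ℚ → ∣ q ∣ ≤ 1ℚ
  ∣∣≤1 0≤q q<1 = subst (_≤ 1ℚ) (sym (ℚ.0≤p⇒∣p∣≡p 0≤q)) (ℚ.<⇒≤ q<1)

abstract
  Π°-enumeration : ∀ {d} (Δ : LatticeSimplex d) → Enumeration (Π° Δ)
  Π°-enumeration Δ = Basis.pointEnumeration (cone Δ) (cone-independent Δ)
    (λ q → (0ℚ ℚ.<? q) ×-dec (q ℚ.<? 1ℚ)) (λ (0<q , q<1) → ∣∣≤1 (ℚ.<⇒≤ 0<q) q<1)

  Λ-enumeration : ∀ {d} (Δ : LatticeSimplex d) → Enumeration (Λ Δ)
  Λ-enumeration Δ = Basis.coordEnumeration (cone Δ) (cone-independent Δ)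
    (λ q → (0ℚ ℚ.≤? q) ×-dec (q ℚ.<? 1ℚ)) (λ (0≤q , q<1) → ∣∣≤1 0≤q q<1)

------------------------------------------------------------------------
-- The local h*-polynomial

-- Coefficient sequences; only finite sums of monomials are formed.
Polynomial : Set
Polynomial = ℕ → ℕ

t^_ : ℕ → Polynomial
(t^ n) k = if does (n ℕ.≟ k) then 1 else 0

_+ₚ_ : Polynomial → Polynomial → Polynomial
(f +ₚ g) k = f k ℕ.+ g k

0ₚ : Polynomial
0ₚ _ = 0

-- The last coordinate of a point of Π°_Δ is a sum of positive
-- coefficients, so taking its absolute value only changes its type.
l* : ∀ {d} → LatticeSimplex d → Polynomial
l* Δ = List.foldr _+ₚ_ 0ₚ
  (List.map (λ p → t^ ℤ.∣ Vec.last p ∣) (elements (Π°-enumeration Δ)))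

Thin : ∀ {d} → LatticeSimplex d → Set
Thin Δ = ∀ k → l* Δ k ≡ 0ₚ k

------------------------------------------------------------------------
-- The code of a simplex

denominators : ∀ {d} → LatticeSimplex d → List ℕ
denominators Δ =
  List.concatMap (λ x → Vec.toList (Vec.map ↧ₙ_ x)) (elements (Λ-enumeration Δ))

N : ∀ {d} → LatticeSimplex d → ℕ
N Δ = List.foldr lcm 1 (denominators Δ)

private
  lcm-nonZero : ∀ m n .{{_ : ℕ.NonZero m}} .{{_ : ℕ.NonZero n}} → ℕ.NonZero (lcm m n)
  lcm-nonZero m n = ℕ.≢-nonZero (λ eq → ℕ.≢-nonZero⁻¹ (m ℕ.* n) {{ℕ.m*n≢0 m n}}
    (ℕ.0∣⇒≡0 (subst (ℕ._∣ m ℕ.* n) eq (lcm-least {m} {n} (ℕ.m∣m*n n) (ℕ.n∣m*n m)))))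

  lcms-nonZero : ∀ {ns} → All ℕ.NonZero ns → ℕ.NonZero (List.foldr lcm 1 ns)
  lcms-nonZero []           = _
  lcms-nonZero (_∷_ {n} {ns} n≢0 ns≢0) =
    lcm-nonZero n (List.foldr lcm 1 ns) {{n≢0}} {{lcms-nonZero ns≢0}}

  ↧ₙ-nonZero : ∀ {n} (x : Vec ℚ n) → All ℕ.NonZero (Vec.toList (Vec.map ↧ₙ_ x))
  ↧ₙ-nonZero []      = []
  ↧ₙ-nonZero (q ∷ x) = _ ∷ ↧ₙ-nonZero x

instance
  N-nonZero : ∀ {d} {Δ : LatticeSimplex d} → ℕ.NonZero (N Δ)
  N-nonZero {Δ = Δ} = lcms-nonZero (All.concat⁺ (All.map⁺
    (All.tabulate {xs = elements (Λ-enumeration Δ)} (λ {x} _ → ↧ₙ-nonZero x))))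

-- ℤ_n is Fin n, a residue class being given by its least representative.
ℤ[_]^_ : ℕ → ℕ → Set
ℤ[ n ]^ m = Vector (Fin n) m

Code : ∀ {d} (Δ : LatticeSimplex d) → Pred (ℤ[ N Δ ]^ suc d) 0ℓ
Code Δ c = ∃ λ x → Λ Δ x × (∀ i → ι (+ toℕ (c i)) ≡ ι (+ N Δ) * lookup x i)

Matrix : ℕ → ℕ → ℕ → Set
Matrix n m k = Fin m → Fin k → Fin n

column : ∀ {n m k} → Matrix n m k → Fin k → ℤ[ n ]^ m
column g i j = g j i

_·_ : ∀ {n m} .{{_ : ℕ.NonZero n}} → ℤ[ n ]^ m → ℤ[ n ]^ m → Fin n
u · v = ∑ℕ.sum (λ j → toℕ (u j) ℕ.* toℕ (v j)) mod _

-- The ith coordinate of ∑ⱼ yⱼ (row j) is y · (column i).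
RowSpan : ∀ {n m k} .{{_ : ℕ.NonZero n}} → Matrix n m k → Pred (ℤ[ n ]^ k) 0ℓ
RowSpan g c = ∃ λ y → ∀ i → c i ≡ y · column g i

RowsGenerate : ∀ {n m k} .{{_ : ℕ.NonZero n}} → Matrix n m k → Pred (ℤ[ n ]^ k) 0ℓ → Set
RowsGenerate g C = ∀ c → C c ⇔ RowSpan g c

Hyperplane : ∀ {n m k} .{{_ : ℕ.NonZero n}} → Matrix n m k → Fin k → Pred (ℤ[ n ]^ m) 0ℓ
Hyperplane {n} g i x = column g i · x ≡ 0 mod n

{-# OPTIONS --safe #-}

-- Scaling coordinates by N identifies the points of Π°_Δ with the codewords
-- having no zero coordinate. The codewords are y ↦ (y · gᵢ)ᵢ, and the ith
-- coordinate vanishes exactly when y ∈ Hᵢ, so such a codeword exists if and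
-- only if some y avoids every hyperplane.

module Submission where

open import Data.Fin.Base using (Fin; toℕ; fromℕ<)
open import Data.Fin.Properties using (_≟_; any?; toℕ-fromℕ<; toℕ-injective)
open import Data.Integer.Base as ℤ using (+_; -[1+_])
import Data.Integer.Properties as ℤ
open import Data.List.Base as List using (List; []; _∷_)
open import Data.List.Membership.Propositional using (_∈_)
open import Data.List.Membership.Propositional.Properties using (∈-concatMap⁺)
open import Data.List.Relation.Unary.Any as Any using (here; there)
open import Data.Nat.Base as ℕ using (ℕ; suc)
open import Data.Nat.Divisibility using (_∣_; divides; ∣-trans)
open import Data.Nat.DivMod using (_mod_; m%n<n; m*n%n≡0)
open import Data.Nat.LCM using (lcm; m∣lcm[m,n]; n∣lcm[m,n])
import Data.Nat.Properties as ℕ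
open import Data.Nat.Tactic.RingSolver using (solve-∀)
open import Data.Product.Base using (∃; _×_; _,_; proj₁; proj₂)
open import Data.Rational.Base using (mkℚ; 0ℚ; 1ℚ; _*_; _≤_; _<_; *≤*; *<*; ↧ₙ_; toℚᵘ)
import Data.Rational.Properties as ℚ
open import Data.Rational.Unnormalised.Base as ℚᵘ using (mkℚᵘ)
import Data.Rational.Unnormalised.Properties as ℚᵘ
open import Data.Vec.Base as Vec using (Vec; lookup)
open import Data.Vec.Membership.Propositional.Properties using (∈-lookup; ∈-map⁺; ∈-toList⁺)
open import Function.Base using (_∘_)
open import Function.Bundles using (_⇔_; mk⇔; Equivalence)
open import Function.Properties.Equivalence using () renaming (sym to ⇔-sym; trans to ⇔-trans)
open import Relation.Binary.PropositionalEquality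
open import Relation.Nullary using (contradiction)
open import Relation.Nullary.Decidable using (decidable-stable; dec-true)
open import Relation.Unary using (⋃; ∁; Empty; Universal; Decidable)
open import Defs

open Equivalence using (to; from)

∣-foldr-lcm : ∀ {n ns} → n ∈ ns → n ∣ List.foldr lcm 1 ns
∣-foldr-lcm {ns = m ∷ ns} (here refl) = m∣lcm[m,n] m (List.foldr lcm 1 ns)
∣-foldr-lcm {ns = m ∷ ns} (there n∈)  =
  ∣-trans (∣-foldr-lcm n∈) (n∣lcm[m,n] m (List.foldr lcm 1 ns))

-- Completeness of the enumeration puts `x` in the list whose coordinate denominators are folded
-- with `lcm` to give `N Δ`.
↧ₙ∣N : ∀ {d} (Δ : LatticeSimplex d) x → Λ Δ x → ∀ i → ↧ₙ (lookup x i) ∣ N Δ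
↧ₙ∣N Δ x x∈Λ i = ∣-foldr-lcm (∈-concatMap⁺ (λ x → Vec.toList (Vec.map ↧ₙ_ x))
  (Any.map (λ { refl → ∈-toList⁺ (∈-map⁺ ↧ₙ_ (∈-lookup i x)) })
    (from (complete (Λ-enumeration Δ)) x∈Λ)))

ι≃mkℚᵘ : ∀ z → toℚᵘ (ι z) ℚᵘ.≃ mkℚᵘ z 0
ι≃mkℚᵘ z = ℚ.toℚᵘ-fromℚᵘ (mkℚᵘ z 0)

ι-injective : ∀ {x y} → ι x ≡ ι y → x ≡ y
ι-injective {x} {y} eq
  with ℚᵘ.≃-trans (ℚᵘ.≃-sym (ι≃mkℚᵘ x)) (ℚᵘ.≃-trans (ℚ.toℚᵘ-cong eq) (ι≃mkℚᵘ y))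
... | ℚᵘ.*≡* h = trans (sym (ℤ.*-identityʳ x)) (trans h (ℤ.*-identityʳ y))

-- Turns coordinates of points of `Λ` into codeword entries. If `q` is a/b and n = kb, then nq = ka,
-- and a < b gives ka < n, so no reduction modulo n takes place.
scale-to-residue : ∀ n .{{_ : ℕ.NonZero n}} q → 0ℚ ≤ q → q < 1ℚ → ↧ₙ q ∣ n →
                   ∃ λ (c : Fin n) → ι (+ toℕ c) ≡ ι (+ n) * q
scale-to-residue n (mkℚ -[1+ _ ] _ _) (*≤* ()) _ _
scale-to-residue n {{n≢0}} q@(mkℚ (+ a) b-1 _) _ (*<* a<b) (divides k n≡kb) =
  fromℕ< ka<n , ℚ.toℚᵘ-injective (begin
    toℚᵘ (ι (+ toℕ (fromℕ< ka<n)))      ≡⟨ cong (λ m → toℚᵘ (ι (+ m))) (toℕ-fromℕ< ka<n) ⟩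
    toℚᵘ (ι (+ (k ℕ.* a)))              ≈⟨ ι≃mkℚᵘ (+ (k ℕ.* a)) ⟩
    mkℚᵘ (+ (k ℕ.* a)) 0                ≈⟨ ℚᵘ.*≡* cross ⟩
    mkℚᵘ (+ n) 0 ℚᵘ.* mkℚᵘ (+ a) b-1    ≈⟨ ℚᵘ.*-congʳ (ι≃mkℚᵘ (+ n)) ⟨
    toℚᵘ (ι (+ n)) ℚᵘ.* toℚᵘ q          ≈⟨ ℚ.toℚᵘ-homo-* (ι (+ n)) q ⟨
    toℚᵘ (ι (+ n) * q)                  ∎)
  where
  open ℚᵘ.≃-Reasoning
  b = suc b-1

  k≢0 : ℕ.NonZero k
  k≢0 = ℕ.m*n≢0⇒m≢0 k {{subst ℕ.NonZero n≡kb n≢0}}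

  ka<n : k ℕ.* a ℕ.< n
  ka<n = subst (k ℕ.* a ℕ.<_) (sym n≡kb) (ℕ.*-monoʳ-< k {{k≢0}}
    (ℤ.drop‿+<+ (subst₂ ℤ._<_ (ℤ.*-identityʳ (+ a)) (ℤ.*-identityˡ (+ b)) a<b)))

  crossℕ : ∀ k a b → k ℕ.* a ℕ.* (1 ℕ.* b) ≡ k ℕ.* b ℕ.* a ℕ.* 1
  crossℕ = solve-∀

  -- Cross-multiplied form of ka/1 = (n/1)(a/b); the factor `1 ℕ.* b` is the denominator of the
  -- unnormalised product.
  cross : + (k ℕ.* a) ℤ.* + (1 ℕ.* b) ≡ (+ n ℤ.* + a) ℤ.* + 1
  cross = trans (sym (ℤ.pos-* (k ℕ.* a) (1 ℕ.* b)))
    (trans (cong +_ (trans (crossℕ k a b) (cong (λ m → m ℕ.* a ℕ.* 1) (sym n≡kb))))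
    (trans (ℤ.pos-* (n ℕ.* a) 1) (cong (ℤ._* + 1) (ℤ.pos-* n a))))

toℕ-0mod : ∀ n .{{_ : ℕ.NonZero n}} → toℕ (0 mod n) ≡ 0
toℕ-0mod n = trans (toℕ-fromℕ< (m%n<n 0 n)) (m*n%n≡0 0 n)

-- Needed because `RowSpan` puts the column on the right of the product and `Hyperplane` puts it on
-- the left.
·-comm : ∀ {n m} .{{_ : ℕ.NonZero n}} (u v : ℤ[ n ]^ m) → u · v ≡ v · u
·-comm {n} u v = cong (_mod n) (∑ℕ.sum-cong-≗ (λ j → ℕ.*-comm (toℕ (u j)) (toℕ (v j))))

hyperplane? : ∀ {n m k} .{{_ : ℕ.NonZero n}} (g : Matrix n m k) y →
              Decidable (λ i → Hyperplane g i y)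
hyperplane? {n} g y i = (column g i · y) ≟ (0 mod n)

-- The double negation can be removed constructively, since membership in one of finitely many
-- hyperplanes is decidable.
Empty-∁⇔Universal : ∀ {n m k} .{{_ : ℕ.NonZero n}} (g : Matrix n m k) →
  Empty (∁ (⋃ (Fin k) (Hyperplane g))) ⇔ Universal (⋃ (Fin k) (Hyperplane g))
Empty-∁⇔Universal g = mk⇔ (λ ∅ y → decidable-stable (any? (hyperplane? g y)) (∅ y))
  (λ covered y y∉ → y∉ (covered y))

-- Coefficients are natural numbers, so nothing cancels: each point of `Π° Δ` adds 1 to the
-- coefficient at its own height.
Thin⇔Empty-Π° : ∀ {d} (Δ : LatticeSimplex d) → Thin Δ ⇔ Empty (Π° Δ)
Thin⇔Empty-Π° Δ = mk⇔
  (λ thin p p∈ → positive {p} (from (complete (Π°-enumeration Δ) {p}) p∈) (thin ℤ.∣ Vec.last p ∣))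
  (λ ∅ k → cong (λ ps → l*′ ps k) (empty (λ p p∈ → ∅ p (to (complete (Π°-enumeration Δ) {p}) p∈))))
  where
  -- `l*` with the list as an argument, so that the enumeration can be replaced by `[]` and
  -- `positive` can recurse on membership.
  l*′ : List (Vec ℤ.ℤ _) → Polynomial
  l*′ ps = List.foldr _+ₚ_ 0ₚ (List.map (λ p → t^ ℤ.∣ Vec.last p ∣) ps)

  empty : ∀ {A : Set} {xs : List A} → Empty (_∈ xs) → xs ≡ []
  empty {xs = []}    ∅ = refl
  empty {xs = x ∷ _} ∅ = contradiction (here refl) (∅ x)

  t^n[n]≡1 : ∀ n → (t^ n) n ≡ 1
  t^n[n]≡1 n rewrite dec-true (n ℕ.≟ n) refl = refl

  positive : ∀ {p ps} → p ∈ ps → l*′ ps ℤ.∣ Vec.last p ∣ ≢ 0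
  positive {p} (here refl) eq = contradiction
    (trans (sym (t^n[n]≡1 ℤ.∣ Vec.last p ∣)) (ℕ.m+n≡0⇒m≡0 _ eq)) (λ ())
  positive {p} {p′ ∷ _} (there p∈) eq =
    positive p∈ (ℕ.m+n≡0⇒n≡0 ((t^ ℤ.∣ Vec.last p′ ∣) ℤ.∣ Vec.last p ∣) eq)

module _ {d} (Δ : LatticeSimplex d) {m} (g : Matrix (N Δ) m (suc d))
         (generate : RowsGenerate g (Code Δ)) where

  Empty-Π°⇒Universal : Empty (Π° Δ) → Universal (⋃ (Fin (suc d)) (Hyperplane g))
  Empty-Π°⇒Universal ∅ y = decidable-stable (any? (hyperplane? g y)) λ y∉ →
    -- If `y` avoids every hyperplane, the codeword it spans comes from some `x` in `Λ Δ`. A zero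
    -- coordinate of `x` would make the matching entry 0 and put `y` on a hyperplane, so all
    -- coordinates are strictly positive.
    let x , (bounds , p , p≐) , Nx = from (generate _) (y , λ i → refl)
        x≢0 = λ i (x≡0 : lookup x i ≡ 0ℚ) → y∉ (i , toℕ-injective (begin
          toℕ (column g i · y)  ≡⟨ cong toℕ (·-comm (column g i) y) ⟩
          toℕ (y · column g i)  ≡⟨ ℤ.+-injective (ι-injective (trans (Nx i)
                                     (trans (cong (ι (+ N Δ) *_) x≡0) (ℚ.*-zeroʳ (ι (+ N Δ)))))) ⟩
          0                     ≡⟨ toℕ-0mod (N Δ) ⟨
          toℕ (0 mod N Δ)       ∎))
        0<x = λ i → ℚ.≰⇒> (λ x≤0 → x≢0 i (ℚ.≤-antisym x≤0 (proj₁ (bounds i))))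
    in ∅ p (x , (λ i → 0<x i , proj₂ (bounds i)) , p≐)
    where open ≡-Reasoning

  Universal⇒Empty-Π° : Universal (⋃ (Fin (suc d)) (Hyperplane g)) → Empty (Π° Δ)
  Universal⇒Empty-Π° covered p (a , bounds , p≐) =
    -- The coefficients `a` of `p`, scaled by `N Δ`, form a codeword `c`, spanned by some `y`. The
    -- hyperplane through `y` forces an entry of `c` to be 0, although `N Δ` times a positive
    -- coefficient is positive.
    let y , c≡y· = to (generate c) (a , a∈Λ , proj₂ ∘ residue)
        i , y∈Hᵢ = covered y
        cᵢ≡0 = trans (cong toℕ (trans (c≡y· i) (trans (·-comm y (column g i)) y∈Hᵢ)))
                     (toℕ-0mod (N Δ))
    -- `ι (+ 0)` computes to `0ℚ`, so the equation matches the left side of `0<Na i`.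
    in ℚ.<-irrefl (trans (cong (λ k → ι (+ k)) (sym cᵢ≡0)) (proj₂ (residue i)))
                  (0<Na i)
    where
    a∈Λ : Λ Δ a
    a∈Λ = (λ i → ℚ.<⇒≤ (proj₁ (bounds i)) , proj₂ (bounds i)) , p , p≐

    residue : ∀ i → ∃ λ (cᵢ : Fin (N Δ)) → ι (+ toℕ cᵢ) ≡ ι (+ N Δ) * lookup a i
    residue i = scale-to-residue (N Δ) (lookup a i) (proj₁ (proj₁ a∈Λ i)) (proj₂ (bounds i))
                  (↧ₙ∣N Δ a a∈Λ i)

    c : ℤ[ N Δ ]^ suc d
    c = proj₁ ∘ residue

    0<Na : ∀ i → 0ℚ < ι (+ N Δ) * lookup a i
    0<Na i = subst (_< ι (+ N Δ) * lookup a i) (ℚ.*-zeroʳ (ι (+ N Δ)))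
      (ℚ.*-monoʳ-<-pos (ι (+ N Δ)) {{ℚ.normalize-pos (N Δ) 1}} (proj₁ (bounds i)))

corollary2p11 : ∀ {d : ℕ} (Δ : LatticeSimplex d) {m : ℕ} (g : Matrix (N Δ) m (suc d)) →
    RowsGenerate g (Code Δ) →
    (Thin Δ ⇔ Empty (∁ (⋃ (Fin (suc d)) (Hyperplane g)))) ×
    (Thin Δ ⇔ Universal (⋃ (Fin (suc d)) (Hyperplane g)))
corollary2p11 Δ g generate = ⇔-trans thin⇔universal (⇔-sym (Empty-∁⇔Universal g)) , thin⇔universal
  where
  thin⇔universal : Thin Δ ⇔ Universal (⋃ (Fin _) (Hyperplane g))
  thin⇔universal = ⇔-trans (Thin⇔Empty-Π° Δ)
    (mk⇔ (Empty-Π°⇒Universal Δ g generate) (Universal⇒Empty-Π° Δ g generate))
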